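{- $B$-translation is an embedding of $\mathbf{L_1}$ in $\mathbf{K4}$; that is, for every formula $\phi$ of $\mathbf{L_1}$, $\vdash_{\mathbf{L_1}}\phi$ if and only if $\vdash_{\mathbf{K4}}B(\phi)$.
   Context: The system $\mathbf{L_1}$ (Leśniewski's propositional ontology): fix a countably infinite set of name variables. The atomic formulas are exactly the expressions $\epsilon ab$ with $a,b$ name variables (possibly equal); formulas are built from atomic formulas by $\vee$ and $\neg$, the other connectives being the usual classical abbreviations. $\mathbf{L_1}$ is a Hilbert-style system of classical propositional logic (with modus ponens) over these formulas with the additional axiom schemata, for all name variables $a,b,c$: (Ax1) $\epsilon ab \supset \epsilon aa$; (Ax2) $(\epsilon ab \wedge \epsilon bc) \supset \epsilon ac$; (Ax3) $(\epsilon ab \wedge \epsilon bc) \supset \epsilon ba$. $B$-translation: to each name variable $a$ corresponds a propositional variable $p_a$, with distinct name variables corresponding to distinct propositional variables. $B$ maps formulas of $\mathbf{L_1}$ to propositional modal formulas by $B(\phi\vee\psi)=B(\phi)\vee B(\psi)$, $B(\neg\phi)=\neg B(\phi)$, $B(\epsilon ab)=p_a\wedge\Box(p_a\supset p_b)\wedge\bigl(p_b\supset\Box(p_b\supset p_a)\bigr)$. $\mathbf{K4}$ is $\mathbf{K}+\Box\phi\supset\Box\Box\phi$, i.e. the smallest normal modal logic (containing $\mathbf{K}$, closed under modus ponens, substitution and necessitation) containing this schema. -}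

module Defs where

open import Data.Nat using (ℕ)

-- The Hilbert–Ackermann axiom schemata for classical propositional logic
-- (complete with modus ponens), over any formulas with primitive ¬ and ∨.

module Classical {F : Set} (¬_ : F → F) (_∨_ : F → F → F) where

  infixr 6 _∧_
  infixr 4 _⊃_

  _⊃_ : F → F → F
  φ ⊃ ψ = (¬ φ) ∨ ψ

  _∧_ : F → F → F
  φ ∧ ψ = ¬ ((¬ φ) ∨ (¬ ψ))

  data Axiom : F → Set where
    taut : ∀ φ     → Axiom ((φ ∨ φ) ⊃ φ)
    add  : ∀ φ ψ   → Axiom (φ ⊃ (φ ∨ ψ))
    perm : ∀ φ ψ   → Axiom ((φ ∨ ψ) ⊃ (ψ ∨ φ))
    sum  : ∀ φ ψ χ → Axiom ((ψ ⊃ χ) ⊃ ((φ ∨ ψ) ⊃ (φ ∨ χ)))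

NameVar : Set
NameVar = ℕ

PropVar : Set
PropVar = ℕ

module L₁ where

  infix  8 ¬_
  infixr 5 _∨_
  infix  2 ⊢_

  data Formula : Set where
    ε   : NameVar → NameVar → Formula
    ¬_  : Formula → Formula
    _∨_ : Formula → Formula → Formula

  open Classical ¬_ _∨_ public

  data ⊢_ : Formula → Set where
    classical : ∀ {φ} → Axiom φ → ⊢ φ
    ax1 : ∀ a b   → ⊢ ε a b ⊃ ε a a
    ax2 : ∀ a b c → ⊢ (ε a b ∧ ε b c) ⊃ ε a c
    ax3 : ∀ a b c → ⊢ (ε a b ∧ ε b c) ⊃ ε b a
    mp  : ∀ {φ ψ} → ⊢ φ ⊃ ψ → ⊢ φ → ⊢ ψ

module K4 where

  infix  8 ¬_ □_
  infixr 5 _∨_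
  infix  2 ⊢_

  data Formula : Set where
    var : PropVar → Formula
    ¬_  : Formula → Formula
    _∨_ : Formula → Formula → Formula
    □_  : Formula → Formula

  open Classical ¬_ _∨_ public

  substitute : (PropVar → Formula) → Formula → Formula
  substitute σ (var q) = σ q
  substitute σ (¬ φ)   = ¬ substitute σ φ
  substitute σ (φ ∨ ψ) = substitute σ φ ∨ substitute σ ψ
  substitute σ (□ φ)   = □ substitute σ φ

  -- As an inductive family, ⊢_ is the smallest set of formulas with these
  -- closure properties.
  data ⊢_ : Formula → Set where
    classical : ∀ {φ} → Axiom φ → ⊢ φ
    k    : ∀ φ ψ   → ⊢ □ (φ ⊃ ψ) ⊃ (□ φ ⊃ □ ψ)
    four : ∀ φ     → ⊢ □ φ ⊃ □ (□ φ)
    mp   : ∀ {φ ψ} → ⊢ φ ⊃ ψ → ⊢ φ → ⊢ ψ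
    sub  : ∀ {φ} σ → ⊢ φ → ⊢ substitute σ φ
    nec  : ∀ {φ}   → ⊢ φ → ⊢ □ φ

B : (NameVar → PropVar) → L₁.Formula → K4.Formula
B p (L₁.ε a b)   = var (p a) ∧ □ (var (p a) ⊃ var (p b))
                     ∧ (var (p b) ⊃ □ (var (p b) ⊃ var (p a)))
  where open K4
B p (L₁.¬ φ)     = K4.¬ B p φ
B p (φ L₁.∨ ψ)   = B p φ K4.∨ B p ψ

{-# OPTIONS --safe #-}

-- Soundness of the translation only needs K.  For the converse, a set of names
-- with a relation ε obeying the axioms yields a transitive model of depth one: a root
-- that sees one leaf for each name, where p_a holds at leaf i iff ε i a, and at
-- the root iff ε a a.  Then B (ε a b) holds at the root iff ε a b.  Instead of
-- arguing by countermodels, the truth values of this model are taken to be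
-- L₁-formulas themselves, so a K4-proof of B φ becomes an L₁-proof of a formula
-- equivalent to φ; only the finitely many names of φ are needed as leaves, so
-- that □ is a finite conjunction.

module Submission where

open import Defs
open import Data.List using (List; []; _∷_; _++_; map)
open import Data.List.Membership.Propositional using (_∈_)
open import Data.List.Membership.Propositional.Properties using (∈-++⁺ˡ; ∈-++⁺ʳ; ∈-map⁺; ∈-map⁻)
open import Data.List.Relation.Unary.Any using (here; there)
open import Data.Maybe using (Maybe; just; nothing)
open import Data.Nat using (_≟_)
open import Data.Product using (_×_; _,_; proj₁)
open import Function using (_∘_)
open import Function.Definitions using (Injective)
open import Function.Bundles using (_⇔_; mk⇔)
open import Relation.Binary.PropositionalEquality using (_≡_; refl; sym; cong; cong₂; subst; subst₂)
open import Relation.Nullary using (yes; no; contradiction)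

-- Classical propositional calculus with hypotheses

module Deduction
  {F : Set} (¬_ : F → F) (_∨_ : F → F → F)
  (⊢_ : F → Set)
  (classical : ∀ {φ} → Classical.Axiom ¬_ _∨_ φ → ⊢ φ)
  (mp : ∀ {φ ψ} → ⊢ (Classical._⊃_ ¬_ _∨_ φ ψ) → ⊢ φ → ⊢ ψ)
  where

  open Classical ¬_ _∨_

  infix  2 _⊩_
  infixl 9 _·_

  -- Hypotheses meet only modus ponens; all other rules act on theorems, which enter through `thm`.
  -- This keeps the deduction theorem valid for K4, where necessitating a hypothesis would break it.
  data _⊩_ (Γ : List F) : F → Set where
    hyp : ∀ {φ} → φ ∈ Γ → Γ ⊩ φ
    thm : ∀ {φ} → ⊢ φ → Γ ⊩ φ
    _·_ : ∀ {φ ψ} → Γ ⊩ φ ⊃ ψ → Γ ⊩ φ → Γ ⊩ ψ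

  closed : ∀ {φ} → [] ⊩ φ → ⊢ φ
  closed (thm d) = d
  closed (d · e) = mp (closed d) (closed e)

  private variable
    Γ : List F
    φ ψ χ : F

  #0 : φ ∷ Γ ⊩ φ
  #0 = hyp (here refl)

  #1 : ψ ∷ φ ∷ Γ ⊩ φ
  #1 = hyp (there (here refl))

  ax : Axiom φ → Γ ⊩ φ
  ax a = thm (classical a)

  ∨-swap : Γ ⊩ φ ∨ ψ → Γ ⊩ ψ ∨ φ
  ∨-swap d = ax (perm _ _) · d

  ∨-introˡ : Γ ⊩ φ ⊃ (φ ∨ ψ)
  ∨-introˡ = ax (add _ _)

  ∨-mapʳ : Γ ⊩ ψ ⊃ χ → Γ ⊩ φ ∨ ψ → Γ ⊩ φ ∨ χ
  ∨-mapʳ f d = ax (sum _ _ _) · f · d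

  ⊃-trans : Γ ⊩ φ ⊃ ψ → Γ ⊩ ψ ⊃ χ → Γ ⊩ φ ⊃ χ
  ⊃-trans f g = ∨-mapʳ g f

  ∨-introʳ : Γ ⊩ ψ ⊃ (φ ∨ ψ)
  ∨-introʳ = ⊃-trans ∨-introˡ (ax (perm _ _))

  ⊃-refl : Γ ⊩ φ ⊃ φ
  ⊃-refl = ⊃-trans ∨-introˡ (ax (taut _))

  ∨-elim : Γ ⊩ φ ⊃ χ → Γ ⊩ ψ ⊃ χ → Γ ⊩ (φ ∨ ψ) ⊃ χ
  ∨-elim f g =
    ⊃-trans (ax (sum _ _ _) · g) (⊃-trans (ax (perm _ _))
      (⊃-trans (ax (sum _ _ _) · f) (ax (taut _))))

  ∨-exchange : Γ ⊩ φ ∨ (ψ ∨ χ) → Γ ⊩ ψ ∨ (φ ∨ χ)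
  ∨-exchange d =
    ∨-elim (⊃-trans ∨-introˡ ∨-introʳ) (ax (sum _ _ _) · ∨-introʳ) · d

  deduction : φ ∷ Γ ⊩ ψ → Γ ⊩ φ ⊃ ψ
  deduction (hyp (here refl)) = ⊃-refl
  deduction (hyp (there i))   = ∨-introʳ · hyp i
  deduction (thm d)           = ∨-introʳ · thm d
  deduction (d · e)           =
    -- Exchanging antecedents and chaining yields `φ ⊃ (φ ⊃ ψ)`, which this line contracts.
    ∨-elim ∨-introˡ ⊃-refl
      · ⊃-trans (deduction e) (∨-exchange (deduction d))

  ¬¬-intro : Γ ⊩ φ ⊃ ¬ (¬ φ)
  ¬¬-intro = ∨-swap ⊃-refl

  ¬¬-elim : Γ ⊩ (¬ (¬ φ)) ⊃ φ
  ¬¬-elim = ∨-swap (∨-mapʳ ¬¬-intro (∨-swap ⊃-refl))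

  contraposition : Γ ⊩ φ ⊃ ψ → Γ ⊩ (¬ ψ) ⊃ (¬ φ)
  contraposition f = ∨-swap (∨-mapʳ ¬¬-intro f)

  ∧-elimˡ : Γ ⊩ φ ∧ ψ → Γ ⊩ φ
  ∧-elimˡ d = ¬¬-elim · (contraposition ∨-introˡ · d)

  ∧-elimʳ : Γ ⊩ φ ∧ ψ → Γ ⊩ ψ
  ∧-elimʳ d = ¬¬-elim · (contraposition ∨-introʳ · d)

  -- φ ∧ ψ is literally ¬ (φ ⊃ ¬ ψ).
  ∧-intro : Γ ⊩ φ → Γ ⊩ ψ → Γ ⊩ φ ∧ ψ
  ∧-intro d e =
    contraposition (∨-elim (contraposition (∨-introʳ · d)) ⊃-refl)
      · (¬¬-intro · e)

  ∨-map : ∀ {φ′ ψ′} → Γ ⊩ φ ⊃ φ′ → Γ ⊩ ψ ⊃ ψ′ → Γ ⊩ (φ ∨ ψ) ⊃ (φ′ ∨ ψ′)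
  ∨-map f g = ∨-elim (⊃-trans f ∨-introˡ) (⊃-trans g ∨-introʳ)

-- Modal derivations of the translated axioms

module Soundness (p : NameVar → PropVar) where

  open K4
  open Deduction ¬_ _∨_ ⊢_ classical mp

  □-trans : ∀ {Γ φ ψ χ} → Γ ⊩ □ (φ ⊃ ψ) → Γ ⊩ □ (ψ ⊃ χ) → Γ ⊩ □ (φ ⊃ χ)
  □-trans d e =
    -- With `¬ φ` as the fixed disjunct, `sum` is the transitivity of implication; `k` distributes
    -- the box over it twice.
    thm (k _ _) · (thm (k _ _) · thm (nec (classical (sum _ _ _))) · e) · d

  □-refl : ∀ {Γ φ} → Γ ⊩ □ (φ ⊃ φ)
  □-refl = thm (nec (closed ⊃-refl))

  B-axiom : ∀ {φ} → L₁.Axiom φ → Axiom (B p φ)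
  B-axiom (Classical.taut φ)    = taut _
  B-axiom (Classical.add φ ψ)   = add _ _
  B-axiom (Classical.perm φ ψ)  = perm _ _
  B-axiom (Classical.sum φ ψ χ) = sum _ _ _

  B-ε-intro : ∀ {Γ} a b →
    Γ ⊩ var (p a) → Γ ⊩ □ (var (p a) ⊃ var (p b)) →
    Γ ⊩ var (p b) ⊃ □ (var (p b) ⊃ var (p a)) → Γ ⊩ B p (L₁.ε a b)
  B-ε-intro a b d e f = ∧-intro d (∧-intro e f)

  module _ {Γ} {a b : NameVar} (d : Γ ⊩ B p (L₁.ε a b)) where
    B-ε-fst : Γ ⊩ var (p a)
    B-ε-fst = ∧-elimˡ d

    B-ε-incl : Γ ⊩ □ (var (p a) ⊃ var (p b))
    B-ε-incl = ∧-elimˡ (∧-elimʳ d)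

    B-ε-excl : Γ ⊩ var (p b) ⊃ □ (var (p b) ⊃ var (p a))
    B-ε-excl = ∧-elimʳ (∧-elimʳ d)

  B-sound : ∀ {φ} → L₁.⊢ φ → ⊢ B p φ
  B-sound (L₁.classical a) = classical (B-axiom a)
  B-sound (L₁.ax1 a b) = closed (deduction
    (B-ε-intro a a (B-ε-fst {a = a} {b} #0) □-refl (deduction □-refl)))
  B-sound (L₁.ax2 a b c) = closed (deduction
    (B-ε-intro a c (B-ε-fst {a = a} {b} (∧-elimˡ #0))
      (□-trans (B-ε-incl {a = a} {b} (∧-elimˡ #0)) (B-ε-incl {a = b} {c} (∧-elimʳ #0)))
      (deduction
        -- Given `p c`, the second premise boxes `p c ⊃ p b`; it also supplies `p b`, which releases
        -- the boxed `p b ⊃ p a` of the first.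
        (□-trans (B-ε-excl {a = b} {c} (∧-elimʳ #1) · #0)
          (B-ε-excl {a = a} {b} (∧-elimˡ #1) · B-ε-fst {a = b} {c} (∧-elimʳ #1))))))
  B-sound (L₁.ax3 a b c) = closed (deduction
    (B-ε-intro b a (B-ε-fst {a = b} {c} (∧-elimʳ #0))
      (B-ε-excl {a = a} {b} (∧-elimˡ #0) · B-ε-fst {a = b} {c} (∧-elimʳ #0))
      (∨-introʳ · B-ε-incl {a = a} {b} (∧-elimˡ #0))))
  B-sound (L₁.mp d e) = mp (B-sound d) (B-sound e)

-- Kripke models with L₁-formulas as truth values

open L₁
open Deduction ¬_ _∨_ ⊢_ classical mp

-- The language has no constant for truth, so some fixed theorem serves as the empty conjunction.
⋀ : {A : Set} → List A → (A → Formula) → Formula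
⋀ []       f = ε 0 0 ⊃ ε 0 0
⋀ (x ∷ xs) f = f x ∧ ⋀ xs f

module _ {A : Set} where

  ⋀-intro : ∀ {Γ} {f : A → Formula} xs → (∀ {x} → x ∈ xs → Γ ⊩ f x) → Γ ⊩ ⋀ xs f
  ⋀-intro []       d = ⊃-refl
  ⋀-intro (x ∷ xs) d = ∧-intro (d (here refl)) (⋀-intro xs (d ∘ there))

  ⋀-elim : ∀ {Γ} {f : A → Formula} {x xs} → Γ ⊩ ⋀ xs f → x ∈ xs → Γ ⊩ f x
  ⋀-elim d (here refl) = ∧-elimˡ d
  ⋀-elim d (there i)   = ⋀-elim (∧-elimʳ d) i

  ⋀-cong : ∀ {f g : A → Formula} → (∀ x → f x ≡ g x) → ∀ xs → ⋀ xs f ≡ ⋀ xs g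
  ⋀-cong f≡g []       = refl
  ⋀-cong f≡g (x ∷ xs) = cong₂ _∧_ (f≡g x) (⋀-cong f≡g xs)

module Kripke {World : Set} (successors : World → List World)
  (transitive : ∀ u {v w} → v ∈ successors u → w ∈ successors v → w ∈ successors u)
  where

  Valuation : Set
  Valuation = World → PropVar → Formula

  ⟦_⟧ : K4.Formula → Valuation → World → Formula
  ⟦ K4.var q ⟧ V w = V w q
  ⟦ K4.¬ φ   ⟧ V w = ¬ ⟦ φ ⟧ V w
  ⟦ φ K4.∨ ψ ⟧ V w = ⟦ φ ⟧ V w ∨ ⟦ ψ ⟧ V w
  ⟦ K4.□ φ   ⟧ V w = ⋀ (successors w) (⟦ φ ⟧ V)

  ⟦substitute⟧ : ∀ σ φ V w →
    ⟦ K4.substitute σ φ ⟧ V w ≡ ⟦ φ ⟧ (λ v q → ⟦ σ q ⟧ V v) w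
  ⟦substitute⟧ σ (K4.var q) V w = refl
  ⟦substitute⟧ σ (K4.¬ φ)   V w = cong ¬_ (⟦substitute⟧ σ φ V w)
  ⟦substitute⟧ σ (φ K4.∨ ψ) V w = cong₂ _∨_ (⟦substitute⟧ σ φ V w) (⟦substitute⟧ σ ψ V w)
  ⟦substitute⟧ σ (K4.□ φ)   V w = ⋀-cong (⟦substitute⟧ σ φ V) (successors w)

  ⟦axiom⟧ : ∀ {φ} → K4.Axiom φ → ∀ V w → Axiom (⟦ φ ⟧ V w)
  ⟦axiom⟧ (Classical.taut φ)    V w = taut _
  ⟦axiom⟧ (Classical.add φ ψ)   V w = add _ _
  ⟦axiom⟧ (Classical.perm φ ψ)  V w = perm _ _
  ⟦axiom⟧ (Classical.sum φ ψ χ) V w = sum _ _ _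

  -- The induction needs every valuation, since a substitution is absorbed into `V`, and every
  -- world, for necessitation.
  K4-sound : ∀ {φ} → K4.⊢ φ → ∀ V w → ⊢ ⟦ φ ⟧ V w
  K4-sound (K4.classical a) V w = classical (⟦axiom⟧ a V w)
  K4-sound (K4.k φ ψ) V w = closed (deduction (deduction
    (⋀-intro _ λ i → ⋀-elim {f = ⟦ φ K4.⊃ ψ ⟧ V} #1 i · ⋀-elim {f = ⟦ φ ⟧ V} #0 i)))
  K4-sound (K4.four φ) V w = closed (deduction
    (⋀-intro _ λ i → ⋀-intro _ λ j → ⋀-elim {f = ⟦ φ ⟧ V} #0 (transitive w i j)))
  K4-sound (K4.mp d e) V w = mp (K4-sound d V w) (K4-sound e V w)
  K4-sound (K4.sub {φ} σ d) V w =
    subst ⊢_ (sym (⟦substitute⟧ σ φ V w)) (K4-sound d _ w)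
  K4-sound (K4.nec {φ} d) V w =
    closed (⋀-intro {f = ⟦ φ ⟧ V} _ λ {v} _ → thm (K4-sound d V v))

-- The depth-one model on the names of a formula

names : Formula → List NameVar
names (ε a b) = a ∷ b ∷ []
names (¬ φ)   = names φ
names (φ ∨ ψ) = names φ ++ names ψ

module Completeness (p : NameVar → PropVar) (p-injective : Injective _≡_ _≡_ p)
  (ns : List NameVar) where

  -- The value 0 is junk, taken only outside the image of the list.
  preimage : List NameVar → PropVar → NameVar
  preimage []       q = 0
  preimage (a ∷ as) q with p a ≟ q
  ... | yes _ = a
  ... | no  _ = preimage as q

  -- The search stops at the first entry sharing the variable of `a`; injectivity makes that entry
  -- `a` itself.
  preimage-p : ∀ {a as} → a ∈ as → preimage as (p a) ≡ a
  preimage-p {a} {b ∷ as} i with p b ≟ p a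
  ... | yes pb≡pa = p-injective pb≡pa
  preimage-p (here refl) | no pa≢pa = contradiction refl pa≢pa
  preimage-p (there i)   | no _     = preimage-p i

  -- The root is nothing, and just i is the leaf of the name i.
  successors : Maybe NameVar → List (Maybe NameVar)
  successors nothing  = map just ns
  successors (just _) = []

  transitive : ∀ u {v w} → v ∈ successors u → w ∈ successors v → w ∈ successors u
  transitive nothing i j with ∈-map⁻ just i
  transitive nothing i () | _ , _ , refl

  open Kripke successors transitive

  V : Valuation
  V nothing  q = ε (preimage ns q) (preimage ns q)
  V (just i) q = ε i (preimage ns q)

  ε-trans : ∀ {Γ a b c} → Γ ⊩ ε a b → Γ ⊩ ε b c → Γ ⊩ ε a c
  ε-trans d e = thm (ax2 _ _ _) · ∧-intro d e

  ε-sym : ∀ {Γ a b c} → Γ ⊩ ε a b → Γ ⊩ ε b c → Γ ⊩ ε b a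
  ε-sym d e = thm (ax3 _ _ _) · ∧-intro d e

  _⟚_ : Formula → Formula → Set
  φ ⟚ ψ = ([] ⊩ φ ⊃ ψ) × ([] ⊩ ψ ⊃ φ)

  -- Phrased with decoded names because `V` produces only those; `preimage-p` later turns them back
  -- into `a` and `b`.
  ⟦Bε⟧ : ∀ a b → let a′ = preimage ns (p a); b′ = preimage ns (p b) in
    a′ ∈ ns → ⟦ B p (ε a b) ⟧ V nothing ⟚ ε a′ b′
  ⟦Bε⟧ a b a′∈ns =
    -- The leaf of `a′` gives `ε a′ a′ ⊃ ε a′ b′`, and `ε a′ a′` is the value of `p a` at the root.
    deduction (⋀-elim {f = ⟦ a⊃b ⟧ V} (∧-elimˡ (∧-elimʳ #0)) (∈-map⁺ just a′∈ns) · ∧-elimˡ #0) ,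
    deduction (∧-intro (thm (ax1 _ _) · #0) (∧-intro (⋀-intro _ incl) (deduction (⋀-intro _ excl))))
    where
    a′ = preimage ns (p a)
    b′ = preimage ns (p b)
    a⊃b = K4.var (p a) K4.⊃ K4.var (p b)
    b⊃a = K4.var (p b) K4.⊃ K4.var (p a)

    incl : ∀ {v} → v ∈ successors nothing → ε a′ b′ ∷ [] ⊩ ⟦ a⊃b ⟧ V v
    incl i with ∈-map⁻ just i
    ... | _ , _ , refl = deduction (ε-trans #0 #1)

    excl : ∀ {v} → v ∈ successors nothing → ε b′ b′ ∷ ε a′ b′ ∷ [] ⊩ ⟦ b⊃a ⟧ V v
    excl i with ∈-map⁻ just i
    -- The root value `ε b′ b′` is the second premise that lets `ax3` reverse `ε a′ b′`.
    ... | _ , _ , refl = deduction (ε-trans #0 (ε-sym (hyp (there (there (here refl)))) #1))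

  -- Negation swaps the two implications, so the induction carries both.
  ⟦B⟧ : ∀ φ → (∀ {a} → a ∈ names φ → a ∈ ns) → ⟦ B p φ ⟧ V nothing ⟚ φ
  ⟦B⟧ (ε a b) ⊆ns =
    subst₂ (λ a′ b′ → ⟦ B p (ε a b) ⟧ V nothing ⟚ ε a′ b′) (preimage-p a∈ns)
      (preimage-p (⊆ns (there (here refl))))
      (⟦Bε⟧ a b (subst (_∈ ns) (sym (preimage-p a∈ns)) a∈ns))
    where a∈ns = ⊆ns (here refl)
  ⟦B⟧ (¬ φ) ⊆ns with ⟦B⟧ φ ⊆ns
  ... | f , g = contraposition g , contraposition f
  ⟦B⟧ (φ ∨ ψ) ⊆ns with ⟦B⟧ φ (⊆ns ∘ ∈-++⁺ˡ) | ⟦B⟧ ψ (⊆ns ∘ ∈-++⁺ʳ (names φ))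
  ... | f , g | f′ , g′ = ∨-map f f′ , ∨-map g g′

  B-complete : ∀ φ → (∀ {a} → a ∈ names φ → a ∈ ns) → K4.⊢ B p φ → ⊢ φ
  B-complete φ ⊆ns d = mp (closed (proj₁ (⟦B⟧ φ ⊆ns))) (K4-sound d V nothing)

corollary6p5 : (p : NameVar → PropVar) → Injective _≡_ _≡_ p →
    (φ : L₁.Formula) → (L₁.⊢ φ) ⇔ (K4.⊢ B p φ)
corollary6p5 p p-injective φ = mk⇔ (Soundness.B-sound p)
  (Completeness.B-complete p p-injective (names φ) φ (λ i → i))
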